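{- Let $G$ be a strongly connected digraph. Then the following are equivalent: (i) there exists an expansion $\varphi\colon G'\to G$ such that $G'$ is a cactus digraph; (ii) $G$ does not have a doubly bidirectionally connected pair.
   Context: A digraph is a pair $G=(V,A)$ with $V$ a finite set of vertices and $A\subset V\times V$ a set of arcs, without loops: $(v,v)\notin A$ for all $v\in V$. An arc $(x,y)$ is an arc from $x$ to $y$. A path of length $n$ from $x$ to $y$ is a sequence of vertices $(x_0,x_1,\dots,x_n)$ with $x_0=x$, $x_n=y$ and $(x_{i-1},x_i)\in A$ for $1\le i\le n$. The vertex $x_{n-1}$ is called the preterminal vertex of the path. A path is simple if $x_0,\dots,x_n$ are distinct. A cycle is a path (of length $n\ge 1$) with $x_0=x_n$; it is simple if $x_0,\dots,x_{n-1}$ are distinct. Cycles are regarded as subdigraphs, i.e. cycles that differ only in the choice of starting vertex (cyclic rotation) are the same cycle. $G$ is strongly connected if for any $x,y\in V$ there is a path from $x$ to $y$. A digraph morphism $\varphi\colon G'\to G$ from $G'=(V',A')$ to $G=(V,A)$ is a pair of maps $\varphi_V\colon V'\to V$, $\varphi_A\colon A'\to A$ with $\varphi_A((v',w'))=(\varphi_V(v'),\varphi_V(w'))$ for every $(v',w')\in A'$. An expansion of $G$ is a digraph $G'=(V',A')$ together with a digraph morphism $\varphi\colon G'\to G$ such that $\varphi_V$ is surjective, $\varphi_A$ is surjective, and whenever $(x,y)\in A$, $y'\in V'$ and $\varphi_V(y')=y$, there exists a unique arc $(x',y')\in A'$ (with terminal vertex $y'$) such that $\varphi_V(x')=x$.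 A cactus digraph is a strongly connected digraph in which each arc is contained in exactly one simple cycle (the digraph with a single vertex and no arc is a cactus digraph). A doubly bidirectionally connected pair of $G=(V,A)$ is a pair $(p,q)\in V\times V$ such that $p\ne q$, there exist two simple paths from $p$ to $q$ with different preterminal vertices, and there exist two simple paths from $q$ to $p$ with different preterminal vertices. -}

module Defs where

open import Data.Fin.Base using (Fin)
open import Data.List.Base using (List; []; _∷_; _++_; map; last; length)
open import Data.List.Membership.Propositional using (_∈_)
open import Data.List.Relation.Unary.Unique.Propositional using (Unique)
open import Data.Maybe.Base using (Maybe)
open import Data.Nat.Base using (ℕ; _≥_)
open import Data.Product.Base using (∃; ∃₂; _×_; _,_; proj₁; proj₂)
open import Data.Product using (∃!)
open import Function.Definitions using (StrictlySurjective)
open import Level using (0ℓ)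
open import Relation.Binary.Core using (Rel)
open import Relation.Binary.Construct.Closure.ReflexiveTransitive using (Star; ε; _◅_)
open import Relation.Binary.Definitions using (Decidable; Irreflexive)
open import Relation.Binary.PropositionalEquality using (_≡_; _≢_)

record Digraph : Set₁ where
  field
    order    : ℕ
    Arc      : Rel (Fin order) 0ℓ
    arc?     : Decidable Arc
    loopless : Irreflexive _≡_ Arc

  V : Set
  V = Fin order

  -- The set A ⊆ V × V.  Its elements are compared by `_≈ₐ_`, that is, as pairs
  -- of vertices: `Arc` may be proof-relevant, but there are no multiple arcs.
  A : Set
  A = ∃ λ (e : V × V) → Arc (proj₁ e) (proj₂ e)

  _≈ₐ_ : Rel A 0ℓ
  e ≈ₐ f = proj₁ e ≡ proj₁ f

  Path : Rel V 0ℓ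
  Path = Star Arc

  -- x₀, …, xₙ
  vertices : ∀ {x y} → Path x y → List V
  vertices {x} ε       = x ∷ []
  vertices {x} (_ ◅ p) = x ∷ vertices p

  arcs : ∀ {x y} → Path x y → List (V × V)
  arcs ε                     = []
  arcs {x} (_◅_ {j = z} _ p) = (x , z) ∷ arcs p

  -- x₀, …, xₙ₋₁
  sources : ∀ {x y} → Path x y → List V
  sources p = map proj₁ (arcs p)

  -- xₙ₋₁, and `nothing` for a path of length 0.
  preterminal : ∀ {x y} → Path x y → Maybe V
  preterminal p = last (sources p)

  IsSimplePath : ∀ {x y} → Path x y → Set
  IsSimplePath p = Unique (vertices p)

  record Cycle : Set where
    field
      {base}   : V
      path     : Path base base
      nonempty : length (arcs path) ≥ 1

  open Cycle public

  IsSimpleCycle : Cycle → Set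
  IsSimpleCycle c = Unique (sources (path c))

  -- Equality up to cyclic rotation.
  _≈ᶜ_ : Rel Cycle 0ℓ
  c ≈ᶜ d = ∃₂ λ us vs → sources (path c) ≡ us ++ vs × sources (path d) ≡ vs ++ us

  StronglyConnected : Set
  StronglyConnected = ∀ x y → Path x y

  IsCactus : Set
  IsCactus = StronglyConnected ×
    (∀ {x y} → Arc x y → ∃! _≈ᶜ_ λ c → IsSimpleCycle c × (x , y) ∈ arcs (path c))

  TwoSimplePaths : Rel V 0ℓ
  TwoSimplePaths p q = ∃₂ λ (π ρ : Path p q) →
    IsSimplePath π × IsSimplePath ρ × preterminal π ≢ preterminal ρ

  DoublyBidirectionallyConnected : Rel V 0ℓ
  DoublyBidirectionallyConnected p q =
    p ≢ q × TwoSimplePaths p q × TwoSimplePaths q p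

open Digraph using (V; A; Arc)

record Morphism (G′ G : Digraph) : Set where
  field
    φV        : V G′ → V G
    preserves : ∀ {x y} → Arc G′ x y → Arc G (φV x) (φV y)

  φA : A G′ → A G
  φA ((x , y) , a) = (φV x , φV y) , preserves a

record Expansion (G′ G : Digraph) : Set where
  field
    morphism : Morphism G′ G

  open Morphism morphism public

  field
    φV-surjective : StrictlySurjective _≡_ φV
    φA-surjective : StrictlySurjective (Digraph._≈ₐ_ G) φA
    unique-lift   : ∀ {x y} → Arc G x y → ∀ y′ → φV y′ ≡ y →
                    ∃! _≡_ λ x′ → Arc G′ x′ y′ × φV x′ ≡ x

{-# OPTIONS --safe #-}
module Submission where

-- Write x ▷ w if two distinct in-neighbours of w can be reached from x without
-- passing through w, that is, if x ≠ w and there are two simple paths from x to w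
-- with different preterminal vertices.  A strongly connected digraph is a cactus
-- iff x ▷ w never holds.
--
-- (i) ⇒ (ii): if p ▷ q and q ▷ p in G, both relations lift to every vertex over
-- q and over p in the cactus.  Hence any simple path of the cactus starting over
-- p or q can be prolonged backwards for ever, although the cactus is finite.
--
-- (ii) ⇒ (i): now ▷ is asymmetric, and then it is transitive, so it has a maximal
-- vertex r.  Every w ≠ r has exactly one in-neighbour that can be reached from r
-- without passing through w.  These parents form an out-tree rooted at r, and
-- every other arc goes from a vertex back to one of its ancestors.  The cactus is
-- then grown from r: at each vertex n, every back arc b → n gets its own cycle,
-- which consists of fresh copies of the tree path from n to b.  The feet of the
-- cycles get deeper in the tree, so the growth stops.

open import Data.Empty using (⊥; ⊥-elim)
open import Data.Fin.Base using (Fin; zero; suc)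
open import Data.Fin.Induction using (spo-noetherian)
open import Data.Fin.Properties using (_≟_; any?; injective⇒≤)
open import Data.List.Base
  using ( List; []; _∷_; _++_; _∷ʳ_; [_]; last; length; lookup; filter; deduplicate
        ; allFin; cartesianProduct; cartesianProductWith )
open import Data.List.Membership.Propositional using (_∈_; _∉_; find)
open import Data.List.Membership.Propositional.Properties
  using ( ∈-lookup; ∈-allFin; ∈-cartesianProduct⁺; ∈-cartesianProductWith⁺
        ; ∈-filter⁺; ∈-filter⁻; ∈-deduplicate⁺ )
open import Data.List.Properties
  using (++-identityʳ; ∷-injective; ∷ʳ-injectiveˡ; ≡-dec; length-++)
open import Data.List.Relation.Binary.Disjoint.Propositional using (Disjoint)
open import Data.List.Relation.Unary.All as All using (All; []; _∷_)
import Data.List.Relation.Unary.All.Properties as All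
open import Data.List.Relation.Unary.AllPairs using ([]; _∷_)
open import Data.List.Relation.Unary.Any as Any using (here; there)
open import Data.List.Relation.Unary.Any.Properties using (lookup-index)
open import Data.List.Relation.Unary.Unique.DecPropositional.Properties using (deduplicate-!)
open import Data.List.Relation.Unary.Unique.Propositional using (Unique)
import Data.List.Relation.Unary.Unique.Propositional.Properties as Unique
open import Data.Maybe.Base using (Maybe; just; nothing)
open import Data.Maybe.Properties using (just-injective)
open import Data.Nat.Base using (ℕ; zero; suc; _≤_; _<_; _⊔_; z≤n; s≤s)
import Data.Nat.Properties as ℕ
open import Data.Product using (∃!)
open import Data.Product.Base as Product using (∃; ∃₂; _×_; _,_; proj₁; proj₂; swap)
import Data.Product.Properties as Product
open import Data.Sum.Base using (_⊎_; inj₁; inj₂)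
open import Data.Unit.Base using (⊤; tt)
open import Defs
open import Function.Base using (_∘_; id; flip)
open import Function.Bundles using (_⇔_; mk⇔)
open import Induction.WellFounded using (Acc; acc)
open import Relation.Binary.Construct.Closure.ReflexiveTransitive as Star
  using (Star; ε; _◅_; _◅◅_)
open import Relation.Binary.Definitions using (Decidable)
open import Relation.Binary.PropositionalEquality
  using (_≡_; _≢_; refl; sym; trans; cong; cong₂; subst; isEquivalence; resp₂)
open import Relation.Binary.Structures using (IsStrictPartialOrder)
open import Relation.Nullary.Decidable
  using (Dec; yes; no; map′; _×-dec_; _⊎-dec_; ¬?; decidable-stable)
open import Relation.Nullary.Negation.Core using (¬_; contradiction)

open Digraph using (V; Arc; order; StronglyConnected; IsCactus)

-- Repetition-free lists and their rotations

module _ {A : Set} where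

  Unique-++⁻ : ∀ (xs : List A) {ys} → Unique (xs ++ ys) →
               Unique xs × Unique ys × Disjoint xs ys
  Unique-++⁻ []       u       = [] , u , λ ()
  Unique-++⁻ (x ∷ xs) (x∉ ∷ u) with Unique-++⁻ xs u
  ... | uxs , uys , disj = All.++⁻ˡ xs x∉ ∷ uxs , uys , λ where
    (here refl , v∈ys) → All.All¬⇒¬Any (All.++⁻ʳ xs x∉) v∈ys
    (there v∈  , v∈ys) → disj (v∈ , v∈ys)

  Unique-++-comm : ∀ (xs : List A) {ys} → Unique (xs ++ ys) → Unique (ys ++ xs)
  Unique-++-comm xs u with Unique-++⁻ xs u
  ... | uxs , uys , disj = Unique.++⁺ uys uxs (disj ∘ swap)

  Unique-∷ : ∀ {x} {xs : List A} → x ∉ xs → Unique xs → Unique (x ∷ xs)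
  Unique-∷ {xs = xs} x∉xs u = All.¬Any⇒All¬ xs x∉xs ∷ u

  Unique-∷ʳ⁻ : ∀ (xs : List A) {x} → Unique (xs ∷ʳ x) → Unique xs × x ∉ xs
  Unique-∷ʳ⁻ xs u with Unique-++⁻ xs u
  ... | uxs , _ , disj = uxs , λ x∈xs → disj (x∈xs , here refl)

  Unique-middle⁻ : ∀ (xs : List A) {x ys} → Unique (xs ++ x ∷ ys) → x ∉ xs
  Unique-middle⁻ xs u x∈xs with Unique-++⁻ xs u
  ... | _ , _ , disj = disj (x∈xs , here refl)

  lookup-injective : ∀ {xs : List A} → Unique xs →
                     ∀ {i j} → lookup xs i ≡ lookup xs j → i ≡ j
  lookup-injective (_ ∷ _)  {zero}  {zero}  _  = refl
  lookup-injective (x∉ ∷ _) {zero}  {suc j} eq = contradiction eq (All.lookup x∉ (∈-lookup j))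
  lookup-injective (x∉ ∷ _) {suc i} {zero}  eq = contradiction (sym eq) (All.lookup x∉ (∈-lookup i))
  lookup-injective (_ ∷ u)  {suc i} {suc j} eq = cong suc (lookup-injective u eq)

  length-∷ʳ : ∀ (xs : List A) {x} → length (xs ∷ʳ x) ≡ suc (length xs)
  length-∷ʳ xs = trans (length-++ xs) (ℕ.+-comm (length xs) 1)

  last-∷ʳ : ∀ xs {x : A} → last (xs ∷ʳ x) ≡ just x
  last-∷ʳ []           = refl
  last-∷ʳ (_ ∷ [])     = refl
  last-∷ʳ (_ ∷ y ∷ xs) = last-∷ʳ (y ∷ xs)

  -- Both displayed occurrences of `w` are first occurrences in the same list.
  split-unique : ∀ {w : A} us rs {vs ts} → w ∉ us → w ∉ rs →
                 us ++ w ∷ vs ≡ rs ++ w ∷ ts → us ≡ rs × vs ≡ ts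
  split-unique []       []       _    _    refl = refl , refl
  split-unique []       (r ∷ rs) _    w∉rs eq   =
    contradiction (here (proj₁ (∷-injective eq))) w∉rs
  split-unique (u ∷ us) []       w∉us _    eq   =
    contradiction (here (sym (proj₁ (∷-injective eq)))) w∉us
  split-unique (u ∷ us) (r ∷ rs) w∉us w∉rs eq
    with refl , eq′ ← ∷-injective eq
    with refl , refl ← split-unique us rs (w∉us ∘ there) (w∉rs ∘ there) eq′ = refl , refl

  rotation-at : ∀ {w : A} {ys} us vs → vs ++ us ≡ w ∷ ys →
                ∃₂ λ us′ vs′ → us ++ vs ≡ us′ ++ w ∷ vs′ × ys ≡ vs′ ++ us′
  rotation-at us (v ∷ vs) refl = us , vs , refl , refl
  rotation-at us []       refl = [] , _ , ++-identityʳ us , sym (++-identityʳ _)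

  -- The head `w` occurs only once in `us ++ vs`, so it fixes the place where the list is cut. This
  -- compares two cycles that start at the same vertex.
  rotation-unique : ∀ {w : A} {ys zs} us vs rs ts → Unique (us ++ vs) → us ++ vs ≡ rs ++ ts →
                    vs ++ us ≡ w ∷ ys → ts ++ rs ≡ w ∷ zs → ys ≡ zs
  rotation-unique us vs rs ts u eq c d
    with us′ , vs′ , eq₁ , refl ← rotation-at us vs c
       | rs′ , ts′ , eq₂ , refl ← rotation-at rs ts d
    with refl , refl ← split-unique us′ rs′
           (Unique-middle⁻ us′ (subst Unique eq₁ u))
           (Unique-middle⁻ rs′ (subst Unique (trans eq eq₂) u))
           (trans (sym eq₁) (trans eq eq₂)) = refl

Unique-length : ∀ {n} {xs : List (Fin n)} → Unique xs → length xs ≤ n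
Unique-length u = injective⇒≤ (lookup-injective u)

-- Paths: splitting, simplification, decidable reachability

module Paths (G : Digraph) where
  open Digraph G hiding (V; Arc; order; StronglyConnected; IsCactus)

  private variable x y z : V G

  vertices≡sources∷ʳ : (p : Path x y) → vertices p ≡ sources p ∷ʳ y
  vertices≡sources∷ʳ ε       = refl
  vertices≡sources∷ʳ (_ ◅ p) = cong (_ ∷_) (vertices≡sources∷ʳ p)

  vertices-◅◅ : (p : Path x y) (q : Path y z) → vertices (p ◅◅ q) ≡ sources p ++ vertices q
  vertices-◅◅ ε       q = refl
  vertices-◅◅ (_ ◅ p) q = cong (_ ∷_) (vertices-◅◅ p q)

  sources-◅◅ : (p : Path x y) (q : Path y z) → sources (p ◅◅ q) ≡ sources p ++ sources q
  sources-◅◅ ε       q = refl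
  sources-◅◅ (_ ◅ p) q = cong (_ ∷_) (sources-◅◅ p q)

  sources-snoc : (p : Path x y) (e : Arc G y z) → sources (p ◅◅ e ◅ ε) ≡ vertices p
  sources-snoc p e = trans (sources-◅◅ p (e ◅ ε)) (sym (vertices≡sources∷ʳ p))

  vertices-◅◅-◅ : ∀ {u} (p : Path x y) (e : Arc G y z) (q : Path z u) →
                  vertices (p ◅◅ e ◅ q) ≡ vertices p ++ vertices q
  vertices-◅◅-◅ ε       e q = refl
  vertices-◅◅-◅ (_ ◅ p) e q = cong (_ ∷_) (vertices-◅◅-◅ p e q)

  vertices-snoc : (p : Path x y) (e : Arc G y z) → vertices (p ◅◅ e ◅ ε) ≡ vertices p ∷ʳ z
  vertices-snoc p e = vertices-◅◅-◅ p e ε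

  preterminal-snoc : (p : Path x y) (e : Arc G y z) → preterminal (p ◅◅ e ◅ ε) ≡ just y
  preterminal-snoc p e =
    trans (cong last (trans (sources-snoc p e) (vertices≡sources∷ʳ p))) (last-∷ʳ (sources p))

  target∈ : (p : Path x y) → y ∈ vertices p
  target∈ ε       = here refl
  target∈ (_ ◅ p) = there (target∈ p)

  source∈ : (p : Path x y) → x ∈ vertices p
  source∈ ε       = here refl
  source∈ (_ ◅ _) = here refl

  data Snoc : Path x y → Set where
    empty : Snoc (ε {x = x})
    snoc  : (p : Path x y) (e : Arc G y z) → Snoc (p ◅◅ e ◅ ε)

  snocView : (p : Path x y) → Snoc p
  snocView ε = empty
  snocView (e ◅ p) with snocView p
  ... | empty    = snoc ε e
  ... | snoc q f = snoc (e ◅ q) f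

  splitAt : ∀ {v} (p : Path x y) → v ∈ vertices p →
            ∃₂ λ (q : Path x v) (r : Path v y) → p ≡ q ◅◅ r
  splitAt ε       (here refl) = ε , ε , refl
  splitAt (e ◅ p) (here refl) = ε , e ◅ p , refl
  splitAt (e ◅ p) (there v∈p) with q , r , refl ← splitAt p v∈p = e ◅ q , r , refl

  splitAtArc : ∀ {u v} (p : Path x y) → (u , v) ∈ arcs p →
               ∃₂ λ (q : Path x u) (e : Arc G u v) → ∃ λ (r : Path v y) → p ≡ q ◅◅ e ◅ r
  splitAtArc (e ◅ p) (here refl) = ε , e , p , refl
  splitAtArc (e ◅ p) (there ∈p) with q , f , r , refl ← splitAtArc p ∈p = e ◅ q , f , r , refl

  simplify : Path x y → ∃ λ (p : Path x y) → IsSimplePath p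
  simplify ε = ε , [] ∷ []
  simplify {x = x} (e ◅ p) with simplify p
  ... | q , simple with Any.any? (x ≟_) (vertices q)
  ...   | no x∉q = e ◅ q , Unique-∷ x∉q simple
  -- `x` recurs on the simple tail: the loop back to it is cut out.
  ...   | yes x∈q with q₁ , q₂ , refl ← splitAt q x∈q =
    q₂ , proj₁ (proj₂ (Unique-++⁻ (sources q₁) (subst Unique (vertices-◅◅ q₁ q₂) simple)))

  ReachableIn : ℕ → V G → V G → Set
  ReachableIn zero    x y = x ≡ y
  ReachableIn (suc k) x y = x ≡ y ⊎ ∃ λ z → Arc G x z × ReachableIn k z y

  reachableIn? : ∀ k → Decidable (ReachableIn k)
  reachableIn? zero    x y = x ≟ y
  reachableIn? (suc k) x y = (x ≟ y) ⊎-dec any? λ z → arc? x z ×-dec reachableIn? k z y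

  path⇒reachableIn : ∀ {k} (p : Path x y) → length (vertices p) ≤ suc k → ReachableIn k x y
  path⇒reachableIn {k = zero}  ε       _       = refl
  path⇒reachableIn {k = suc k} ε       _       = inj₁ refl
  path⇒reachableIn {k = zero}  (_ ◅ ε) (s≤s ())
  path⇒reachableIn {k = zero}  (_ ◅ _ ◅ _) (s≤s ())
  path⇒reachableIn {k = suc k} (e ◅ p) (s≤s l) = inj₂ (_ , e , path⇒reachableIn p l)

  reachableIn⇒path : ∀ k → ReachableIn k x y → Path x y
  reachableIn⇒path zero    refl               = ε
  reachableIn⇒path (suc k) (inj₁ refl)        = ε
  reachableIn⇒path (suc k) (inj₂ (_ , e , r)) = e ◅ reachableIn⇒path k r

  -- A path can be made simple and then has at most `order G` vertices, so a search through
  -- `order G` arcs suffices, with one arc to spare.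
  path? : Decidable Path
  path? x y = map′ (reachableIn⇒path (order G))
    (λ p → let q , simple = simplify p in
           path⇒reachableIn q (ℕ.m≤n⇒m≤1+n (Unique-length simple)))
    (reachableIn? (order G) x y)

-- Deletion of a vertex and the relation `▷`

infixl 6 _─_

-- `w` stays as an isolated vertex, so that both digraphs have the same vertex type.
_─_ : (G : Digraph) → V G → Digraph
G ─ w = record
  { order    = order G
  ; Arc      = λ x y → Arc G x y × x ≢ w × y ≢ w
  ; arc?     = λ x y → Digraph.arc? G x y ×-dec ¬? (x ≟ w) ×-dec ¬? (y ≟ w)
  ; loopless = λ x≡y (e , _) → Digraph.loopless G x≡y e
  }

module Branching (G : Digraph) where
  open Digraph G hiding (V; Arc; order; StronglyConnected; IsCactus)
  open Paths G

  private variable w x y z : V G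

  -- Beware that Path─ w w w is inhabited, by ε.
  Path─ : V G → V G → V G → Set
  Path─ w = Digraph.Path (G ─ w)

  vertices─ : Path─ w x y → List (V G)
  vertices─ {w} = Digraph.vertices (G ─ w)

  include : Path─ w x y → Path x y
  include = Star.map proj₁

  vertices-include : (p : Path─ w x y) → vertices (include p) ≡ vertices─ p
  vertices-include ε       = refl
  vertices-include (_ ◅ p) = cong (_ ∷_) (vertices-include p)

  avoids : (p : Path─ w x y) → y ≢ w → w ∉ vertices─ p
  avoids ε                   y≢w (here w≡y) = y≢w (sym w≡y)
  avoids ((_ , x≢w , _) ◅ p) y≢w (here w≡x) = x≢w (sym w≡x)
  avoids (_ ◅ p)             y≢w (there w∈) = avoids p y≢w w∈

  ∉⇒source≢ : (p : Path x y) → w ∉ vertices p → x ≢ w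
  ∉⇒source≢ p w∉p refl = w∉p (source∈ p)

  prefix : (p : Path x y) → w ∉ vertices p → z ∈ vertices p → Path─ w x z
  prefix ε       _   (here refl) = ε
  prefix (_ ◅ _) _   (here refl) = ε
  prefix (e ◅ p) w∉p (there z∈p) =
    (e , ∉⇒source≢ (e ◅ p) w∉p , ∉⇒source≢ p (w∉p ∘ there)) ◅ prefix p (w∉p ∘ there) z∈p

  restrict : (p : Path x y) → w ∉ vertices p → Path─ w x y
  restrict p w∉p = prefix p w∉p (target∈ p)

  suffix : (p : Path x y) → w ∉ vertices p → z ∈ vertices p → Path─ w z y
  suffix ε       w∉p (here refl) = ε
  suffix (e ◅ p) w∉p (here refl) = restrict (e ◅ p) w∉p
  suffix (e ◅ p) w∉p (there z∈p) = suffix p (w∉p ∘ there) z∈p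

  -- The hypothesis `y ≢ w` excludes the empty path at `w`, the only path of `G ─ w` that meets `w`.
  simplify─ : Path─ w x y → y ≢ w →
              ∃ λ (p : Path x y) → IsSimplePath p × w ∉ vertices p
  simplify─ {w = w} p y≢w with q , simple ← Paths.simplify (G ─ w) p =
    include q , subst Unique (sym (vertices-include q)) simple ,
    avoids q y≢w ∘ subst (w ∈_) (vertices-include q)

  -- These `a` are the preterminal vertices of the simple paths from `x` to `w`, in a form that is
  -- decidable and can be composed with paths avoiding `w`.
  Access : V G → V G → V G → Set
  Access x w a = Arc G a w × Path─ w x a

  infix 4 _▷_

  _▷_ : V G → V G → Set
  x ▷ w = ∃₂ λ a b → a ≢ b × Access x w a × Access x w b

  arc⇒≢ : Arc G x y → x ≢ y
  arc⇒≢ e x≡y = loopless x≡y e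

  access⇒≢ : ∀ {a} → Access x w a → x ≢ w
  access⇒≢ (e , ε)                 = arc⇒≢ e
  access⇒≢ (_ , (_ , x≢w , _) ◅ _) = x≢w

  access? : ∀ x w a → Dec (Access x w a)
  access? x w a = arc? a w ×-dec Paths.path? (G ─ w) x a

  ▷? : Decidable _▷_
  ▷? x w = any? λ a → any? λ b → ¬? (a ≟ b) ×-dec access? x w a ×-dec access? x w b

  ▷⇒≢ : x ▷ w → x ≢ w
  ▷⇒≢ (_ , _ , _ , α , _) = access⇒≢ α

  access⇒simple : ∀ {a} → Access x w a →
                  ∃ λ (p : Path x w) → IsSimplePath p × preterminal p ≡ just a
  access⇒simple {w = w} (e , p) with simplify─ p (arc⇒≢ e)
  ... | q , simple , w∉q = q ◅◅ e ◅ ε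
      , subst Unique (sym (vertices-snoc q e)) (Unique-++-comm [ w ] (Unique-∷ w∉q simple))
      , preterminal-snoc q e

  simple-snoc⁻ : ∀ {a} (p : Path x a) (e : Arc G a w) → IsSimplePath (p ◅◅ e ◅ ε) →
                 IsSimplePath p × Access x w a
  simple-snoc⁻ p e simple
    with simple-p , w∉p ← Unique-∷ʳ⁻ (vertices p) (subst Unique (vertices-snoc p e) simple) =
    simple-p , e , restrict p w∉p

  simple⇒access : (p : Path x w) → IsSimplePath p → x ≢ w →
                  ∃ λ a → preterminal p ≡ just a × Access x w a
  simple⇒access p simple x≢w with snocView p
  ... | empty    = contradiction refl x≢w
  ... | snoc q e = _ , preterminal-snoc q e , proj₂ (simple-snoc⁻ q e simple)

  ▷⇒TwoSimplePaths : x ▷ w → TwoSimplePaths x w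
  ▷⇒TwoSimplePaths (a , b , a≢b , α , β)
    with p , p-simple , p≡a ← access⇒simple α
       | q , q-simple , q≡b ← access⇒simple β =
    p , q , p-simple , q-simple ,
    λ p≡q → a≢b (just-injective (trans (sym p≡a) (trans p≡q q≡b)))

  TwoSimplePaths⇒▷ : x ≢ w → TwoSimplePaths x w → x ▷ w
  TwoSimplePaths⇒▷ x≢w (p , q , p-simple , q-simple , p≢q)
    with a , p≡a , α ← simple⇒access p p-simple x≢w
       | b , q≡b , β ← simple⇒access q q-simple x≢w =
    a , b , (λ a≡b → p≢q (trans p≡a (trans (cong just a≡b) (sym q≡b)))) , α , β

  access-exists : Path x w → x ≢ w → ∃ λ a → Access x w a
  access-exists p x≢w with q , simple ← simplify p
    with a , _ , α ← simple⇒access q simple x≢w = a , α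

  -- Cactus digraphs are the strongly connected digraphs without `▷`

  NonBranching : Set
  NonBranching = ∀ x w → ¬ (x ▷ w)

  access-unique : ∀ {a b} → ¬ (x ▷ w) → Access x w a → Access x w b → a ≡ b
  access-unique {a = a} {b} ¬▷ α β = decidable-stable (a ≟ b) λ a≢b → ¬▷ (a , b , a≢b , α , β)

  -- The conclusion records the last source `a`, because it tells apart cycles that enter `w` from
  -- different vertices.
  cycle-through : ∀ {a} → Arc G w z → Access z w a →
                  ∃ λ c → IsSimpleCycle c × (w , z) ∈ arcs (path c) ×
                          ∃ λ ys → sources (path c) ≡ w ∷ ys × last ys ≡ just a
  cycle-through {w = w} e (f , p) with q , simple , w∉q ← simplify─ p (arc⇒≢ f) =
    record { path = e ◅ q ◅◅ f ◅ ε ; nonempty = s≤s z≤n } ,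
    Unique-∷ (w∉q ∘ subst (w ∈_) (sources-snoc q f)) (subst Unique (sym (sources-snoc q f)) simple) ,
    here refl , _ , refl , preterminal-snoc q f

  -- If x ▷ w through a and b, then the first arc of a simple path from w to x
  -- lies on a simple cycle through a and on one through b.
  cactus⇒nonBranching : IsCactus G → NonBranching
  cactus⇒nonBranching (connected , unique) x w (a , b , a≢b , α , β)
    with simplify (connected w x)
  ... | ε     , _      = access⇒≢ α refl
  ... | e ◅ p , simple
    with w∉p ← Unique.Unique[x∷xs]⇒x∉xs simple
    with c , uc , e∈c , ys , c≡ , ys-last ← cycle-through e (Product.map₂ (restrict p w∉p ◅◅_) α)
       | d , ud , e∈d , zs , d≡ , zs-last ← cycle-through e (Product.map₂ (restrict p w∉p ◅◅_) β)
    with o , (uo , _) , rotate ← unique e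
    with us , vs , o≡ , c≡′ ← rotate {c} (uc , e∈c)
       | rs , ts , o≡′ , d≡′ ← rotate {d} (ud , e∈d) =
    a≢b (just-injective (trans (sym ys-last) (trans (cong last ys≡zs) zs-last)))
    where
    ys≡zs : ys ≡ zs
    ys≡zs = rotation-unique us vs rs ts (subst Unique o≡ uo) (trans (sym o≡) o≡′)
              (trans (sym c≡′) c≡) (trans (sym d≡′) d≡)

  -- Induction from the end: both preterminal vertices give access to `y`, so they agree and the
  -- last arcs can be removed. The bound `k` is the induction measure, since what remains is not a
  -- subterm.
  simple-unique : NonBranching → ∀ k (p q : Path x y) → length (vertices p) ≤ k →
                  IsSimplePath p → IsSimplePath q → vertices p ≡ vertices q
  simple-unique nb zero    (_ ◅ _) q ()
  simple-unique nb (suc k) p q l simple-p simple-q with snocView p | snocView q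
  ... | empty    | empty    = refl
  ... | empty    | snoc s f = ⊥-elim (access⇒≢ (proj₂ (simple-snoc⁻ s f simple-q)) refl)
  ... | snoc r e | empty    = ⊥-elim (access⇒≢ (proj₂ (simple-snoc⁻ r e simple-p)) refl)
  ... | snoc r e | snoc s f
    with simple-r , α ← simple-snoc⁻ r e simple-p
       | simple-s , β ← simple-snoc⁻ s f simple-q
    with refl ← access-unique (nb _ _) α β =
    trans (vertices-snoc r e) (trans (cong (_∷ʳ _) r≡s) (sym (vertices-snoc s f)))
    where
    r≡s : vertices r ≡ vertices s
    r≡s = simple-unique nb k r s
            (ℕ.≤-pred (subst (_≤ suc k)
              (trans (cong length (vertices-snoc r e)) (length-∷ʳ (vertices r))) l))
            simple-r simple-s

  sources-unique : NonBranching → (p q : Path x y) → IsSimplePath p → IsSimplePath q →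
                   sources p ≡ sources q
  sources-unique nb p q simple-p simple-q = ∷ʳ-injectiveˡ (sources p) (sources q)
    (trans (sym (vertices≡sources∷ʳ p))
      (trans (simple-unique nb _ p q ℕ.≤-refl simple-p simple-q) (vertices≡sources∷ʳ q)))

  -- A simple path from `y` back to `x` closes the arc to a simple cycle. Conversely, a simple cycle
  -- through the arc, rotated and with the arc removed, is a simple path from `y` to `x`, and
  -- `sources-unique` applies.
  nonBranching⇒cactus : StronglyConnected G → NonBranching → IsCactus G
  nonBranching⇒cactus connected nb = connected , λ {x} {y} → cycle {x} {y}
    where
    cycle : Arc G x y → ∃! _≈ᶜ_ λ c → IsSimpleCycle c × (x , y) ∈ arcs (path c)
    cycle {x} {y} e with q , simple-q ← simplify (connected y x) =
      c₀ , (Unique-++-comm (sources q) (subst Unique (vertices≡sources∷ʳ q) simple-q) , here refl) ,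
      λ {c} → unique {c}
      where
      c₀ : Cycle
      c₀ = record { path = e ◅ q ; nonempty = s≤s z≤n }

      unique : ∀ {c} → IsSimpleCycle c × (x , y) ∈ arcs (path c) → c₀ ≈ᶜ c
      unique {record { path = p }} (simple-p , e∈p)
        with r , f , s , refl ← splitAtArc p e∈p =
        x ∷ sources s , sources r ,
        cong (x ∷_) (trans (sources-unique nb q (s ◅◅ r) simple-q simple-sr) (sources-◅◅ s r)) ,
        sources-◅◅ r (f ◅ s)
        where
        simple-sr : IsSimplePath (s ◅◅ r)
        simple-sr = subst Unique
          (trans (cong (_∷ʳ x) (sym (sources-◅◅ s r))) (sym (vertices≡sources∷ʳ (s ◅◅ r))))
          (Unique-++-comm [ x ] (Unique-++-comm (sources r)
            (subst Unique (sources-◅◅ r (f ◅ s)) simple-p)))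

-- Lifting `▷` to the cactus: `▷` is asymmetric

module Lifting
  {H G : Digraph} (E : Expansion H G) (nonBranching : Branching.NonBranching H) where

  open Expansion E
  open Digraph H using (Path; vertices; IsSimplePath)
  open Paths H
  open Branching H renaming (Access to Accessᴴ; _▷_ to _▷ᴴ_)
  open Branching G using (_▷_; Access)

  private variable
    p q a : V G
    s t u v w z : V H

  -- Arcs lift once their heads are given, so the path is lifted from its end backwards. Vertices
  -- not over `q` differ from `w`.
  lift-path : ∀ {x y} → Branching.Path─ G q x y → φV t ≡ y → φV w ≡ q →
              ∃ λ s → φV s ≡ x × Path─ w s t
  lift-path ε t↦y _ = _ , t↦y , ε
  lift-path ((e , x≢q , z≢q) ◅ p) t↦y refl
    with z′ , refl , p′ ← lift-path p t↦y refl
    with s , (e′ , refl) , _ ← unique-lift e z′ refl =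
    s , refl , (e′ , x≢q ∘ cong φV , z≢q ∘ cong φV) ◅ p′

  -- Only the end `w` can be prescribed: the lifts of two accesses from `p` may start at different
  -- vertices over `p`.
  lift-access : Access p q a → φV w ≡ q →
                ∃₂ λ s b → φV s ≡ p × φV b ≡ a × Accessᴴ s w b
  lift-access {w = w} (e , π) w↦q
    with b , (e′ , b↦a) , _ ← unique-lift e w w↦q
    with s , s↦p , π′ ← lift-path π b↦a w↦q = s , b , s↦p , b↦a , e′ , π′

  -- At a common vertex one can switch from `β` to `π`, which leads from `z` to `t` around `v`.
  disjoint? : (π : Path s t) (β : Path z u) → v ∉ vertices π → v ∉ vertices β →
              Disjoint (vertices π) (vertices β) ⊎ Path─ v z t
  disjoint? π β v∉π v∉β with Any.any? (λ x → Any.any? (x ≟_) (vertices β)) (vertices π)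
  ... | no  ¬common = inj₁ λ (x∈π , x∈β) → ¬common (Any.map (λ { refl → x∈β }) x∈π)
  ... | yes common with x , x∈π , x∈β ← find common =
    inj₂ (prefix β v∉β x∈β ◅◅ suffix π v∉π x∈π)

  SimplePathFrom : V H → ℕ → Set
  SimplePathFrom s k = ∃₂ λ t (β : Path s t) → IsSimplePath β × k ≤ length (vertices β)

  prepend : ∀ {k} (π : Path s u) → Arc H u v → (β : Path v t) → IsSimplePath π → IsSimplePath β →
            Disjoint (vertices π) (vertices β) → k ≤ length (vertices β) →
            SimplePathFrom s (suc k)
  prepend π e β simple-π simple-β disjoint k≤ =
    _ , π ◅◅ e ◅ β ,
    subst Unique (sym (vertices-◅◅-◅ π e β)) (Unique.++⁺ simple-π simple-β disjoint) ,
    subst (λ vs → _ ≤ length vs) (sym (vertices-◅◅-◅ π e β))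
      (ℕ.≤-trans (s≤s k≤) (nonempty π))
    where
    nonempty : (π : Path s u) → suc (length (vertices β)) ≤ length (vertices π ++ vertices β)
    nonempty ε       = ℕ.≤-refl
    nonempty (_ ◅ π) = ℕ.m≤n⇒m≤1+n (nonempty π)

  -- If both new pieces met β, the second vertex z of β would satisfy z ▷ v.
  extend : ∀ {s′ b b′ k} → SimplePathFrom v k → b ≢ b′ → Accessᴴ s v b → Accessᴴ s′ v b′ →
           SimplePathFrom s (suc k) ⊎ SimplePathFrom s′ (suc k)
  extend (_ , β , simple-β , k≤) b≢b′ (e , π) (e′ , π′)
    with ρ , simple-ρ , v∉ρ ← simplify─ π (arc⇒≢ e)
       | ρ′ , simple-ρ′ , v∉ρ′ ← simplify─ π′ (arc⇒≢ e′)
    with β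
  ... | ε = inj₁ (prepend ρ e ε simple-ρ simple-β (λ { (x∈ρ , here refl) → v∉ρ x∈ρ }) k≤)
  ... | f ◅ β₀ with v∉β₀ ← Unique.Unique[x∷xs]⇒x∉xs simple-β
    with disjoint? ρ β₀ v∉ρ v∉β₀ | disjoint? ρ′ β₀ v∉ρ′ v∉β₀
  ... | inj₁ disjoint | _ = inj₁ (prepend ρ e (f ◅ β₀) simple-ρ simple-β
          (λ { (x∈ρ , here refl) → v∉ρ x∈ρ ; (x∈ρ , there x∈β) → disjoint (x∈ρ , x∈β) }) k≤)
  ... | inj₂ _ | inj₁ disjoint = inj₂ (prepend ρ′ e′ (f ◅ β₀) simple-ρ′ simple-β
          (λ { (x∈ρ , here refl) → v∉ρ′ x∈ρ ; (x∈ρ , there x∈β) → disjoint (x∈ρ , x∈β) }) k≤)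
  ... | inj₂ σ | inj₂ σ′ = contradiction (_ , _ , b≢b′ , (e , σ) , (e′ , σ′)) (nonBranching _ _)

  -- Each round puts in front a piece from a vertex over `p` to the previous start over `q`; `p` and
  -- `q` swap roles from round to round.
  unbounded : ∀ k → p ▷ q → q ▷ p → ∃ λ s → φV s ≡ p × SimplePathFrom s k
  unbounded {p = p} zero _ _ with s , s↦p ← φV-surjective p = s , s↦p , _ , ε , [] ∷ [] , z≤n
  unbounded (suc k) p▷q@(_ , _ , a≢b , α , β) q▷p
    with v , v↦q , long ← unbounded k q▷p p▷q
    with s , _ , s↦p , refl , α′ ← lift-access α v↦q
       | s′ , _ , s′↦p , refl , β′ ← lift-access β v↦q
    with extend long (a≢b ∘ cong φV) α′ β′
  ... | inj₁ longer = s , s↦p , longer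
  ... | inj₂ longer = s′ , s′↦p , longer

  ▷-asym : p ▷ q → ¬ (q ▷ p)
  ▷-asym p▷q q▷p with _ , _ , _ , _ , simple , long ← unbounded (suc (order H)) p▷q q▷p =
    ℕ.<⇒≱ long (Unique-length simple)

-- Transitivity of `▷` and a maximal vertex

module MaximalVertex (G : Digraph)
  (▷-asym : ∀ {x w} → Branching._▷_ G x w → ¬ Branching._▷_ G w x) where

  open Branching G

  private variable c q s x : V G

  divert : ∀ s → Path─ q x c → c ≢ s → Path─ q s c ⊎ Path─ s x c
  divert {q = q} s p c≢s with Any.any? (s ≟_) (vertices─ p)
  ... | no  s∉p = inj₂ (restrict (include p) (s∉p ∘ subst (s ∈_) (vertices-include p)))
  ... | yes s∈p = inj₁ (proj₁ (proj₂ (Paths.splitAt (G ─ q) p s∈p)))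

  -- If x cannot reach q without passing through s, then s inherits from x its two
  -- ways into q, so that s ▷ q, against asymmetry.
  ▷-trans : x ▷ q → q ▷ s → x ▷ s
  ▷-trans {x} {q} {s} (c , d , c≢d , γ , δ) q▷s@(a , b , a≢b , (e , α) , (f , β))
    with Paths.path? (G ─ s) x q
  ... | yes p = a , b , a≢b , (e , p ◅◅ α) , (f , p ◅◅ β)
  ... | no ¬p = contradiction (c , d , c≢d , reroute γ , reroute δ) (▷-asym q▷s)
    where
    reroute : ∀ {c} → Access x q c → Access s q c
    reroute {c} (g , p) with c ≟ s
    ... | yes refl = g , ε
    ... | no  c≢s with divert s p c≢s
    ...   | inj₁ r = g , r
    ...   | inj₂ r = contradiction (r ◅◅ (g , c≢s , ▷⇒≢ q▷s) ◅ ε) ¬p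

  ▷-isStrictPartialOrder : IsStrictPartialOrder _≡_ _▷_
  ▷-isStrictPartialOrder = record
    { isEquivalence = isEquivalence
    ; irrefl        = λ { refl x▷x → ▷⇒≢ x▷x refl }
    ; trans         = ▷-trans
    ; <-resp-≈      = resp₂ _▷_
    }

  ▷-maximal : V G → ∃ λ r → ∀ w → ¬ (r ▷ w)
  ▷-maximal x = go (spo-noetherian ▷-isStrictPartialOrder x)
    where
    go : ∀ {x} → Acc (flip _▷_) x → ∃ λ r → ∀ w → ¬ (r ▷ w)
    go {x} (acc rec) with any? (▷? x)
    ... | yes (y , x▷y) = go (rec x▷y)
    ... | no  maximal   = x , λ w x▷w → maximal (w , x▷w)

-- The out-tree of parents and its back arcs

module Tree (G : Digraph) (connected : StronglyConnected G)
            (r : V G) (maximal : ∀ w → ¬ Branching._▷_ G r w) where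

  open Branching G

  private variable w x y z : V G

  -- At w = r the vertex is a junk value.
  abstract
    entry : ∀ w → ∃ λ a → w ≢ r → Access r w a
    entry w with w ≟ r
    ... | yes w≡r = r , λ w≢r → contradiction w≡r w≢r
    ... | no  w≢r with a , α ← access-exists (connected r w) (w≢r ∘ sym) = a , λ _ → α

  parent : V G → V G
  parent w = proj₁ (entry w)

  parent-access : w ≢ r → Access r w (parent w)
  parent-access {w} = proj₂ (entry w)

  -- Ancestry is reflexive. A step upwards demands `y ≢ r`, because `parent r` carries no meaning.
  data Ancestor (x : V G) : V G → Set where
    here  : Ancestor x x
    above : y ≢ r → Ancestor x (parent y) → Ancestor x y

  Ancestor-trans : Ancestor x y → Ancestor y z → Ancestor x z
  Ancestor-trans a here          = a
  Ancestor-trans a (above z≢r b) = above z≢r (Ancestor-trans a b)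

  -- The tree path from `r` to `y` consists of the ancestors of `y`: it avoids `w` unless `w` is one
  -- of them.
  ancestor-or-avoids : ∀ w → Ancestor r y → Ancestor w y ⊎ Path─ w r y
  ancestor-or-avoids w here with w ≟ r
  ... | yes refl = inj₁ here
  ... | no  _    = inj₂ ε
  ancestor-or-avoids {y} w (above y≢r a) with y ≟ w | ancestor-or-avoids w a
  ... | yes refl | _      = inj₁ here
  ... | no _     | inj₁ b = inj₁ (above y≢r b)
  ... | no y≢w   | inj₂ p with parent y ≟ w
  ...   | yes refl = inj₁ (above y≢r here)
  ...   | no  p≢w  = inj₂ (p ◅◅ (proj₁ (parent-access y≢r) , p≢w , y≢w) ◅ ε)

  -- If `y` is not an ancestor of `x`, the tree path to `x` avoids `y` and makes `x` an access to
  -- `y` from `r`; by maximality of `r` there is only one.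
  arc-cases′ : Ancestor r x → Arc G x y → (y ≢ r × x ≡ parent y) ⊎ Ancestor y x
  arc-cases′ {y = y} a e with y ≟ r
  ... | yes refl = inj₂ a
  ... | no  y≢r with ancestor-or-avoids y a
  ...   | inj₁ b = inj₂ b
  ...   | inj₂ p = inj₁ (y≢r , access-unique (maximal y) (e , p) (parent-access y≢r))

  -- Along a path from `r`, every arc goes to a child or back to an ancestor, and neither leaves the
  -- tree below `r`.
  root-above : ∀ y → Ancestor r y
  root-above y = go here (connected r y)
    where
    descend : Ancestor z x → Ancestor r x → Ancestor r z
    descend here          a           = a
    descend (above x≢r _) here        = contradiction refl x≢r
    descend (above _ b)   (above _ a) = descend b a

    go : Ancestor r x → Digraph.Path G x y → Ancestor r y
    go a ε       = a
    go a (e ◅ p) with arc-cases′ a e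
    ... | inj₁ (z≢r , refl) = go (above z≢r a) p
    ... | inj₂ b            = go (descend b a) p

  arc-cases : Arc G x y → (y ≢ r × x ≡ parent y) ⊎ Ancestor y x
  arc-cases = arc-cases′ (root-above _)

  size : Ancestor x y → ℕ
  size here        = zero
  size (above _ a) = suc (size a)

  -- Frees `depth` from the particular derivation that `root-above` returns, as `depth-parent`
  -- requires.
  size-unique : (a b : Ancestor r y) → size a ≡ size b
  size-unique here          here          = refl
  size-unique here          (above r≢r _) = contradiction refl r≢r
  size-unique (above r≢r _) here          = contradiction refl r≢r
  size-unique (above _ a)   (above _ b)   = cong suc (size-unique a b)

  depth : V G → ℕ
  depth y = size (root-above y)

  depth-parent : y ≢ r → depth y ≡ suc (depth (parent y))
  depth-parent y≢r = size-unique (root-above _) (above y≢r (root-above _))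

  ancestor⇒depth≤ : Ancestor x y → depth x ≤ depth y
  ancestor⇒depth≤ here          = ℕ.≤-refl
  ancestor⇒depth≤ (above y≢r a) =
    subst (_ ≤_) (sym (depth-parent y≢r)) (ℕ.m≤n⇒m≤1+n (ancestor⇒depth≤ a))

  StrictAncestor : V G → V G → Set
  StrictAncestor x y = y ≢ r × Ancestor x (parent y)

  strict⇒depth< : StrictAncestor x y → depth x < depth y
  strict⇒depth< (y≢r , a) = subst (_ <_) (sym (depth-parent y≢r)) (s≤s (ancestor⇒depth≤ a))

  strict-trans : StrictAncestor x y → Ancestor y z → StrictAncestor x z
  strict-trans s         here          = s
  strict-trans (y≢r , a) (above z≢r b) = z≢r , Ancestor-trans (above y≢r a) b

  ancestor⇒strict : x ≢ y → Ancestor x y → StrictAncestor x y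
  ancestor⇒strict x≢y here          = contradiction refl x≢y
  ancestor⇒strict x≢y (above y≢r a) = y≢r , a

  ancestor? : Decidable Ancestor
  ancestor? x y = go (root-above y)
    where
    go : ∀ {y} → Ancestor r y → Dec (Ancestor x y)
    go {y} a with x ≟ y
    ... | yes refl = yes here
    go here          | no x≢r = no λ { here → x≢r refl ; (above r≢r _) → r≢r refl }
    go (above y≢r a) | no x≢y =
      map′ (above y≢r) (proj₂ ∘ ancestor⇒strict x≢y) (go a)

  strict? : Decidable StrictAncestor
  strict? x y = ¬? (y ≟ r) ×-dec ancestor? x (parent y)

-- Lists of bounded length, bounds of functions on a finite set

module _ {A : Set} where

  listsUpTo : ℕ → List A → List (List A)
  listsUpTo zero    _  = [ [] ]
  listsUpTo (suc k) as = [] ∷ cartesianProductWith _∷_ as (listsUpTo k as)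

  ∈-listsUpTo : ∀ {k as} xs → length xs ≤ k → All (_∈ as) xs → xs ∈ listsUpTo k as
  ∈-listsUpTo {zero}  []       _       _        = here refl
  ∈-listsUpTo {suc k} []       _       _        = here refl
  ∈-listsUpTo {suc k} (x ∷ xs) (s≤s l) (x∈ ∷ xs∈) =
    there (∈-cartesianProductWith⁺ _∷_ x∈ (∈-listsUpTo xs l xs∈))

bounded : ∀ {n} (f : Fin n → ℕ) → ∃ λ b → ∀ i → f i ≤ b
bounded {zero}  f = zero , λ ()
bounded {suc n} f with b , f≤b ← bounded (f ∘ suc) = f zero ⊔ b , λ where
  zero    → ℕ.m≤m⊔n (f zero) b
  (suc i) → ℕ.≤-trans (f≤b i) (ℕ.m≤n⊔m (f zero) b)

-- The cover: nodes, arcs and labels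

module Cover (G : Digraph) (connected : StronglyConnected G)
             (r : V G) (maximal : ∀ w → ¬ Branching._▷_ G r w) where

  open Branching G
  open Tree G connected r maximal

  -- [] is the root.  The node (b , z) ∷ n lies over z, on the cycle attached at n
  -- that is closed by the back arc from b to the vertex under n.
  Node : Set
  Node = List (V G × V G)

  foot : Node → V G
  foot []            = r
  foot ((_ , z) ∷ _) = z

  -- `z` lies on the tree path from `foot n` to `b`, with `foot n` excluded because `n` itself is
  -- the vertex of the cycle there.
  Valid : Node → Set
  Valid []            = ⊤
  Valid ((b , z) ∷ n) = Valid n × Arc G b (foot n) × StrictAncestor (foot n) z × Ancestor z b

  private variable
    b z : V G
    m n u v w : Node

  valid? : ∀ n → Dec (Valid n)
  valid? []            = yes tt
  valid? ((b , z) ∷ n) =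
    valid? n ×-dec Digraph.arc? G b (foot n) ×-dec strict? (foot n) z ×-dec ancestor? z b

  _≟ᴺ_ : (m n : Node) → Dec (m ≡ n)
  _≟ᴺ_ = ≡-dec (Product.≡-dec _≟_ _≟_)

  -- Each entry makes the foot strictly deeper. Hence there are only finitely many valid nodes.
  valid⇒length≤ : ∀ n → Valid n → length n ≤ depth (foot n)
  valid⇒length≤ []      _                 = z≤n
  valid⇒length≤ (_ ∷ n) (vn , _ , s , _) = ℕ.≤-trans (s≤s (valid⇒length≤ n vn)) (strict⇒depth< s)

  -- The predecessor of `(b , z) ∷ n` on its cycle, which is `n` itself when `z` is the first vertex
  -- after the point of attachment.
  up : V G → V G → Node → Node
  up b z n with parent z ≟ foot n
  ... | yes _ = n
  ... | no  _ = (b , parent z) ∷ n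

  up-enter : ∀ b → parent z ≡ foot n → up b z n ≡ n
  up-enter {z} {n} b eq with parent z ≟ foot n
  ... | yes _  = refl
  ... | no ¬eq = contradiction eq ¬eq

  up-walk : ∀ b → parent z ≢ foot n → up b z n ≡ (b , parent z) ∷ n
  up-walk {z} {n} b ¬eq with parent z ≟ foot n
  ... | yes eq = contradiction eq ¬eq
  ... | no _   = refl

  foot-up : ∀ b z n → foot (up b z n) ≡ parent z
  foot-up b z n with parent z ≟ foot n
  ... | yes eq = sym eq
  ... | no _   = refl

  length-up : ∀ b z n → length (up b z n) ≤ suc (length n)
  length-up b z n with parent z ≟ foot n
  ... | yes _ = ℕ.n≤1+n _
  ... | no _  = ℕ.≤-refl

  valid-up : ∀ b z n → Valid ((b , z) ∷ n) → Valid (up b z n)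
  valid-up b z n (vn , e , (z≢r , s) , a) with parent z ≟ foot n
  ... | yes _  = vn
  ... | no neq = vn , e , ancestor⇒strict (neq ∘ sym) s , Ancestor-trans (above z≢r here) a

  valid-back : ∀ {x} → Valid n → Arc G x (foot n) → Ancestor (foot n) x → Valid ((x , x) ∷ n)
  valid-back vn e a = vn , e , ancestor⇒strict (arc⇒≢ e ∘ sym) a , here

  -- The tree arc from `m` down to `n`. It is described from its head `n`, since lifts are sought
  -- for a given head.
  UpStep : Node → Node → Set
  UpStep m []            = ⊥
  UpStep m ((b , z) ∷ n) = m ≡ up b z n

  BackStep : Node → Node → Set
  BackStep m n = ∃ λ b → m ≡ (b , b) ∷ n

  Step : Node → Node → Set
  Step m n = BackStep m n ⊎ UpStep m n

  upStep? : Decidable UpStep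
  upStep? m []            = no λ ()
  upStep? m ((b , z) ∷ n) = m ≟ᴺ up b z n

  step? : Decidable Step
  step? m n = any? (λ b → m ≟ᴺ ((b , b) ∷ n)) ⊎-dec upStep? m n

  -- A back arc changes the length of the node, a tree arc the depth of its foot.
  step-loopless : Valid n → ¬ Step n n
  step-loopless _ (inj₁ (b , eq)) = ℕ.1+n≢n (sym (cong length eq))
  step-loopless {(b , z) ∷ n} (_ , _ , (z≢r , _) , _) (inj₂ eq) =
    ℕ.1+n≢n (trans (sym (depth-parent z≢r)) (cong depth (trans (cong foot eq) (foot-up b z n))))

  step⇒arc : ∀ m n → Valid m → Valid n → Step m n → Arc G (foot m) (foot n)
  step⇒arc _ n (_ , e , _) _ (inj₁ (b , refl)) = e
  step⇒arc _ ((b , z) ∷ n) _ (_ , _ , (z≢r , _) , _) (inj₂ refl) =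
    subst (λ y → Arc G y z) (sym (foot-up b z n)) (proj₁ (parent-access z≢r))

  -- A back arc opens a new cycle attached at `n`, and a tree arc follows the cycle on which `n`
  -- already lies. No tree arc enters the root.
  lift : ∀ {x} n → Valid n → Arc G x (foot n) → ∃ λ m → Valid m × Step m n × foot m ≡ x
  lift n vn e with arc-cases e
  ... | inj₂ a = _ , valid-back vn e a , inj₁ (_ , refl) , refl
  lift []            vn e | inj₁ (r≢r , _)  = contradiction refl r≢r
  lift ((b , z) ∷ n) vn e | inj₁ (_ , refl) =
    up b z n , valid-up b z n vn , inj₂ refl , foot-up b z n

  ¬strict-parent : z ≢ r → ¬ StrictAncestor z (parent z)
  ¬strict-parent z≢r s = ℕ.<-asym (strict⇒depth< s) (strict⇒depth< (z≢r , here))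

  -- The tail of a back arc into `z` is strictly below `z`, that of the tree arc is the parent of
  -- `z`; depth separates them.
  lift-unique : ∀ m m′ n → Valid m → Valid m′ → Valid n → Step m n → Step m′ n →
                foot m ≡ foot m′ → m ≡ m′
  lift-unique _ _ n _ _ _ (inj₁ (_ , refl)) (inj₁ (_ , refl)) refl = refl
  lift-unique _ _ ((_ , _) ∷ _) _ _ _ (inj₂ refl) (inj₂ refl) _ = refl
  lift-unique _ _ ((b , z) ∷ n) (_ , _ , s , _) _ (_ , _ , (z≢r , _) , _)
              (inj₁ (_ , refl)) (inj₂ refl) eq =
    contradiction (subst (StrictAncestor z) (trans eq (foot-up b z n)) s) (¬strict-parent z≢r)
  lift-unique _ _ ((b , z) ∷ n) _ (_ , _ , s , _) (_ , _ , (z≢r , _) , _)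
              (inj₂ refl) (inj₁ (_ , refl)) eq =
    contradiction (subst (StrictAncestor z) (trans (sym eq) (foot-up b z n)) s) (¬strict-parent z≢r)

  -- Tells through which of the cycles attached at w the node v hangs below w, and
  -- is nothing if v is not below w; that is, it names the component of v in the
  -- cover without w.
  label : Node → Node → Maybe (V G)
  label w []            = nothing
  label w ((b , _) ∷ v) with v ≟ᴺ w
  ... | yes _ = just b
  ... | no  _ = label w v

  label-short : ∀ w v → length v ≤ length w → label w v ≡ nothing
  label-short w []      _ = refl
  label-short w ((_ , _) ∷ v) l with v ≟ᴺ w
  ... | yes refl = contradiction l ℕ.1+n≰n
  ... | no  _    = label-short w v (ℕ.≤-trans (ℕ.n≤1+n _) l)

  label-back : ∀ w {b} → label w ((b , b) ∷ w) ≡ just b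
  label-back w with w ≟ᴺ w
  ... | yes _   = refl
  ... | no  w≢w = contradiction refl w≢w

  -- A step pushes, pops or replaces the top entry, and a replacement keeps its `b`. A push or pop
  -- affects the label only if the shorter node is `w`.
  label-invariant : Step u v → u ≢ w → v ≢ w → label w u ≡ label w v
  label-invariant {v = v} {w} (inj₁ (b , refl)) _ v≢w with v ≟ᴺ w
  ... | yes v≡w = contradiction v≡w v≢w
  ... | no  _   = refl
  label-invariant {v = (b , z) ∷ n} {w} (inj₂ refl) u≢w _ with parent z ≟ foot n
  ... | no  _ = refl
  ... | yes _ with n ≟ᴺ w
  ...   | yes n≡w = contradiction n≡w u≢w
  ...   | no  _   = refl

  -- The tail of a back arc into `w` is labelled by its `b`. The tail of the tree arc is no longer
  -- than `w`, so its label is `nothing`.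
  label-injective : Step m w → Step n w → label w m ≡ label w n → m ≡ n
  label-injective {w = w} (inj₁ (b , refl)) (inj₁ (b′ , refl)) eq
    with refl ← trans (sym (label-back w)) (trans eq (label-back w)) = refl
  label-injective {w = w@((b , z) ∷ n)} (inj₁ (c , refl)) (inj₂ refl) eq
    with () ← trans (sym (label-back w)) (trans eq (label-short w (up b z n) (length-up b z n)))
  label-injective {w = w@((b , z) ∷ n)} (inj₂ refl) (inj₁ (c , refl)) eq
    with () ← trans (sym (label-short w (up b z n) (length-up b z n))) (trans eq (label-back w))
  label-injective {w = (b , z) ∷ n} (inj₂ refl) (inj₂ refl) _ = refl

  -- Strong connectivity of the cover

  ValidStep : Node → Node → Set
  ValidStep m n = Valid m × Valid n × Step m n

  descend : ∀ {y} → Ancestor (foot n) y → parent z ≡ y → Valid ((b , z) ∷ n) →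
            Star ValidStep n ((b , z) ∷ n)
  descend {n} {z} {b} a z↑y vz with parent z ≟ foot n
  ... | yes eq = (proj₁ vz , vz , inj₂ (sym (up-enter b eq))) ◅ ε
  descend here z↑y vz | no neq = contradiction z↑y neq
  descend {n} {z} {b} (above _ a) refl vz | no neq
    with vp ← subst Valid (up-walk b neq) (valid-up b z n vz) =
    descend a refl vp ◅◅ (vp , vz , inj₂ (sym (up-walk b neq))) ◅ ε

  root→node : ∀ n → Valid n → Star ValidStep [] n
  root→node []            _  = ε
  root→node ((b , z) ∷ n) vn@(vn′ , _ , (_ , s) , _) = root→node n vn′ ◅◅ descend s refl vn

  climb : ∀ {y} → Ancestor z y → Valid ((b , z) ∷ n) → Valid ((b , y) ∷ n) →
          Star ValidStep ((b , z) ∷ n) ((b , y) ∷ n)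
  climb here _ _ = ε
  climb {z} {b} {n} {y} (above y≢r a) vz@(_ , _ , s , _) vy =
    climb a vz vp ◅◅ (vp , vy , inj₂ (sym (up-walk b neq))) ◅ ε
    where
    -- The walk stays at or below the depth of `z`, which exceeds that of `foot n`, so it never gets
    -- back to `n`.
    neq : parent y ≢ foot n
    neq eq = ℕ.<⇒≱ (strict⇒depth< s) (subst (λ x → _ ≤ depth x) eq (ancestor⇒depth≤ a))
    vp : Valid ((b , parent y) ∷ n)
    vp = subst Valid (up-walk b neq) (valid-up b y n vy)

  -- Follow the cycle to its last vertex `(b , b) ∷ n` and take the back arc to the shorter node
  -- `n`.
  node→root : ∀ n → Valid n → Star ValidStep n []
  node→root []            _ = ε
  node→root ((b , z) ∷ n) vz@(vn , e , s , a) =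
    climb a vz vb ◅◅ (vb , vn , inj₁ (b , refl)) ◅ node→root n vn
    where
    vb : Valid ((b , b) ∷ n)
    vb = vn , e , strict-trans s a , here

  -- The cover as a finite digraph and its projection

  alphabet : List (V G × V G)
  alphabet = cartesianProduct (allFin (order G)) (allFin (order G))

  -- A bound on the depths bounds the length of every valid node. Removing duplicates gives each
  -- node a single index.
  candidates : List Node
  candidates = deduplicate _≟ᴺ_ (listsUpTo (proj₁ (bounded depth)) alphabet)

  nodes : List Node
  nodes = filter valid? candidates

  nodes-unique : Unique nodes
  nodes-unique = Unique.filter⁺ valid?
    (deduplicate-! _≟ᴺ_ (listsUpTo (proj₁ (bounded depth)) alphabet))

  valid⇒∈nodes : Valid n → n ∈ nodes
  valid⇒∈nodes {n} vn = ∈-filter⁺ valid?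
    (∈-deduplicate⁺ _≟ᴺ_ (∈-listsUpTo n
      (ℕ.≤-trans (valid⇒length≤ n vn) (proj₂ (bounded depth) (foot n)))
      (All.universal (λ _ → ∈-cartesianProduct⁺ (∈-allFin _) (∈-allFin _)) n)))
    vn

  node : Fin (length nodes) → Node
  node = lookup nodes

  node-injective : ∀ {i j} → node i ≡ node j → i ≡ j
  node-injective = lookup-injective nodes-unique

  node-valid : ∀ i → Valid (node i)
  node-valid i = proj₂ (∈-filter⁻ valid? {xs = candidates} (∈-lookup i))

  index : Valid n → ∃ λ i → node i ≡ n
  index vn = Any.index (valid⇒∈nodes vn) , sym (lookup-index (valid⇒∈nodes vn))

  cover : Digraph
  cover = record
    { order    = length nodes
    ; Arc      = λ i j → Step (node i) (node j)
    ; arc?     = λ i j → step? (node i) (node j)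
    ; loopless = λ { {i} refl → step-loopless (node-valid i) }
    }

  cover-path : ∀ {i j} → Star ValidStep m n → node i ≡ m → node j ≡ n → Digraph.Path cover i j
  cover-path ε i≡ j≡ with refl ← node-injective (trans i≡ (sym j≡)) = ε
  cover-path ((_ , vn , s) ◅ p) refl j≡ with k , refl ← index vn = s ◅ cover-path p refl j≡

  cover-connected : StronglyConnected cover
  cover-connected i j =
    cover-path (node→root _ (node-valid i) ◅◅ root→node _ (node-valid j)) refl refl

  -- The label is constant along paths avoiding `w`, so both in-neighbours share the label of `x`
  -- and coincide.
  cover-nonBranching : Branching.NonBranching cover
  cover-nonBranching x w (a , b , a≢b , (e , p) , (f , q)) =
    a≢b (node-injective (label-injective e f (trans (sym (constant p)) (constant q))))
    where
    constant : ∀ {x a} → Branching.Path─ cover w x a →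
               label (node w) (node x) ≡ label (node w) (node a)
    constant ε = refl
    constant ((e , x≢w , z≢w) ◅ p) =
      trans (label-invariant e (x≢w ∘ node-injective) (z≢w ∘ node-injective)) (constant p)

  project : V cover → V G
  project i = foot (node i)

  cover-lift : ∀ {x y} → Arc G x y → ∀ j → project j ≡ y →
               ∃! _≡_ λ i → Arc cover i j × project i ≡ x
  cover-lift e j refl with m , vm , s , refl ← lift (node j) (node-valid j) e
    with i , refl ← index vm =
    i , (s , refl) , λ {i′} (s′ , eq) → node-injective
      (lift-unique _ _ (node j) vm (node-valid i′) (node-valid j) s s′ (sym eq))

  -- A path from `x` to `r` is lifted so as to end at the root node.
  project-surjective : ∀ x → ∃ λ i → project i ≡ x
  project-surjective x = go (connected x r)
    where
    go : ∀ {x} → Digraph.Path G x r → ∃ λ i → project i ≡ x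
    go ε with i , eq ← index {[]} tt = i , cong foot eq
    go (e ◅ p) with j , eq ← go p with i , (_ , eq′) , _ ← cover-lift e j eq = i , eq′

  cover-expansion : Expansion cover G
  cover-expansion = record
    { morphism = record
      { φV        = project
      ; preserves = λ {i} {j} → step⇒arc (node i) (node j) (node-valid i) (node-valid j)
      }
    ; φV-surjective = project-surjective
    ; φA-surjective = surjective
    ; unique-lift   = cover-lift
    }
    where
    surjective : ∀ e → ∃ λ f → (project (proj₁ (proj₁ f)) , project (proj₂ (proj₁ f))) ≡ proj₁ e
    surjective ((x , y) , e) with j , j↦y ← project-surjective y
      with i , (s , i↦x) , _ ← cover-lift e j j↦y = ((i , j) , s) , cong₂ _,_ i↦x j↦y

-- The empty digraph and the equivalence

empty-cactus : (G : Digraph) → (V G → ⊥) → IsCactus G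
empty-cactus G empty = (λ x → ⊥-elim (empty x)) , λ {x} → ⊥-elim (empty x)

empty-expansion : (G : Digraph) → (V G → ⊥) → Expansion G G
empty-expansion G empty = record
  { morphism      = record { φV = id ; preserves = id }
  ; φV-surjective = λ x → ⊥-elim (empty x)
  ; φA-surjective = λ e → ⊥-elim (empty (proj₁ (proj₁ e)))
  ; unique-lift   = λ {x} → ⊥-elim (empty x)
  }

corollary2 : (G : Digraph) → Digraph.StronglyConnected G →
    (∃ λ (G′ : Digraph) → Expansion G′ G × Digraph.IsCactus G′)
    ⇔ (¬ (∃₂ λ p q → Digraph.DoublyBidirectionallyConnected G p q))
corollary2 G connected = mk⇔ necessary sufficient
  where
  open Branching G

  necessary : (∃ λ G′ → Expansion G′ G × IsCactus G′) →
              ¬ (∃₂ λ p q → Digraph.DoublyBidirectionallyConnected G p q)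
  necessary (H , E , cactus) (p , q , p≢q , pq , qp) =
    Lifting.▷-asym E (Branching.cactus⇒nonBranching H cactus)
      (TwoSimplePaths⇒▷ p≢q pq) (TwoSimplePaths⇒▷ (p≢q ∘ sym) qp)

  asym : ¬ (∃₂ λ p q → Digraph.DoublyBidirectionallyConnected G p q) →
         ∀ {x w} → x ▷ w → ¬ (w ▷ x)
  asym noPair x▷w w▷x = noPair (_ , _ , ▷⇒≢ x▷w , ▷⇒TwoSimplePaths x▷w , ▷⇒TwoSimplePaths w▷x)

  sufficient : ¬ (∃₂ λ p q → Digraph.DoublyBidirectionallyConnected G p q) →
               ∃ λ G′ → Expansion G′ G × IsCactus G′
  sufficient noPair with any? {P = λ (_ : V G) → ⊤} (λ _ → yes tt)
  -- Without a vertex there is no root to grow from; the empty digraph is a cactus and expands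
  -- itself.
  ... | no  empty   =
    G , empty-expansion G (λ x → empty (x , tt)) , empty-cactus G (λ x → empty (x , tt))
  ... | yes (x , _) with r , maximal ← MaximalVertex.▷-maximal G (asym noPair) x =
    cover , cover-expansion ,
    Branching.nonBranching⇒cactus cover cover-connected cover-nonBranching
    where open Cover G connected r maximal
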